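{- Let $G$ be any graph on $n$ vertices with $M$ edges, and let $k,\bar k>0$ be integers with $k+\bar k=n$. Define $N=\binom n2$, $K=\binom k2$, $\bar K=\binom{\bar k}2$. Let $S$ be a uniformly random $k$-subset of $V(G)$, $\bar S=V(G)\setminus S$, let $x$ be a uniformly random vertex of $S$ and $\bar x$ an independent uniformly random vertex of $\bar S$, and set $S'=(S\setminus\{x\})\cup\{\bar x\}$, $\bar S'=(\bar S\setminus\{\bar x\})\cup\{x\}$. Define \[ W=\frac{e(S)-KM/N}{n},\quad \bar W=\frac{e(\bar S)-\bar KM/N}{n},\quad W'=\frac{e(S')-KM/N}{n},\quad \bar W'=\frac{e(\bar S')-\bar KM/N}{n}, \] and the column vectors $\mathbf W=(W,\bar W)^T$, $\mathbf W'=(W',\bar W')^T$. Then \[ \mathbb{E}[\mathbf W'-\mathbf W\mid \mathbf W]=-\Lambda\mathbf W,\qquad\text{where}\qquad \Lambda=\frac{1}{k\bar k}\begin{pmatrix}n+\bar k-1&k-1\\ \bar k-1&n+k-1\end{pmatrix}. \]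
   Context: For $U\subseteq V(G)$, $e(U)$ denotes the number of edges of the induced subgraph $G[U]$. -}

module Defs where

open import Data.Nat as ℕ using (ℕ; zero; suc; _<ᵇ_; _≡ᵇ_)
open import Data.Nat.Combinatorics using (_C_)
open import Data.Integer using (+_)
open import Data.Bool using (Bool; true; false; not; _∧_; if_then_else_)
open import Data.Fin using (Fin; toℕ)
open import Data.Fin.Subset using (Subset; ⁅_⁆; _∪_; ∁; ∣_∣) renaming (_-_ to _∖ᵥ_)
open import Data.Vec using (Vec; []; _∷_; lookup)
open import Data.List using (List; []; _∷_; map; concatMap; filterᵇ; allFin; cartesianProduct; foldr)
open import Data.Nat.ListAction using () renaming (sum to sumℕ)
open import Data.Product using (_×_; _,_; proj₁; proj₂)
open import Data.Rational using (ℚ; 0ℚ; 1ℚ; _+_; _*_; -_; _-_; _/_)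
open import Data.Rational.Properties using (_≟_)
open import Relation.Nullary using (does)
open import Relation.Binary.PropositionalEquality using (_≡_)

record Graph (n : ℕ) : Set where
  field
    adj    : Fin n → Fin n → Bool
    sym    : ∀ i j → adj i j ≡ adj j i
    irrefl : ∀ i → adj i i ≡ false
open Graph public

ℕ→ℚ : ℕ → ℚ
ℕ→ℚ m = (+ m) / 1

-- division of a rational by a natural number (junk value 0 for divisor 0;
-- it is only ever used with positive divisors below)
_÷ℕ_ : ℚ → ℕ → ℚ
q ÷ℕ zero  = 0ℚ
q ÷ℕ suc m = q * ((+ 1) / suc m)

sumℚ : List ℚ → ℚ
sumℚ = foldr _+_ 0ℚ

e : ∀ {n} → Graph n → Subset n → ℕ
e {n} G U = sumℕ (map f (cartesianProduct (allFin n) (allFin n)))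
  where
  f : Fin n × Fin n → ℕ
  f (i , j) = if (toℕ i <ᵇ toℕ j) ∧ lookup U i ∧ lookup U j ∧ adj G i j then 1 else 0

edges : ∀ {n} → Graph n → ℕ
edges {n} G = e G (Data.Vec.replicate n true)

allSubsets : ∀ n → List (Subset n)
allSubsets zero    = [] ∷ []
allSubsets (suc n) = concatMap (λ v → (true ∷ v) ∷ (false ∷ v) ∷ []) (allSubsets n)

-- Sample space: triples (S , x , x̄) with S a k-subset, x ∈ S, x̄ ∈ V ∖ S.
Outcome : ℕ → Set
Outcome n = Subset n × Fin n × Fin n

Ω : ∀ n → ℕ → List (Outcome n)
Ω n k =
  concatMap (λ S → concatMap (λ x → map (λ x̄ → (S , x , x̄))
                      (filterᵇ (λ x̄ → not (lookup S x̄)) (allFin n)))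
                    (filterᵇ (λ x → lookup S x) (allFin n)))
            (filterᵇ (λ S → ∣ S ∣ ≡ᵇ k) (allSubsets n))

-- Probability of each outcome: S uniform among the (n choose k) k-subsets,
-- x uniform in S (k choices), x̄ independent uniform in S̄ (k̄ choices).
prob : (n k k̄ : ℕ) → ℚ
prob n k k̄ = ((1ℚ ÷ℕ (n C k)) ÷ℕ k) ÷ℕ k̄

𝔼 : (n k k̄ : ℕ) → (Outcome n → ℚ) → ℚ
𝔼 n k k̄ X = sumℚ (map (λ ω → prob n k k̄ * X ω) (Ω n k))

𝟙 : Bool → ℚ
𝟙 true  = 1ℚ
𝟙 false = 0ℚ

eqℚ² : ℚ × ℚ → ℚ × ℚ → Bool
eqℚ² (a , b) (c , d) = does (a ≟ c) ∧ does (b ≟ d)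

module Setup {n : ℕ} (G : Graph n) (k k̄ : ℕ) where
  N K K̄ M : ℕ
  N = n C 2
  K = k C 2
  K̄ = k̄ C 2
  M = edges G

  S̄ : Subset n → Subset n
  S̄ S = ∁ S

  S' : Outcome n → Subset n
  S' (S , x , x̄) = (S ∖ᵥ x) ∪ ⁅ x̄ ⁆

  S̄' : Outcome n → Subset n
  S̄' (S , x , x̄) = (S̄ S ∖ᵥ x̄) ∪ ⁅ x ⁆

  normalise : ℕ → ℕ → ℚ
  normalise eU KK = (ℕ→ℚ eU - ((ℕ→ℚ KK * ℕ→ℚ M) ÷ℕ N)) ÷ℕ n

  𝐖 : Outcome n → ℚ × ℚ
  𝐖 (S , x , x̄) = normalise (e G S) K , normalise (e G (S̄ S)) K̄

  𝐖' : Outcome n → ℚ × ℚ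
  𝐖' ω = normalise (e G (S' ω)) K , normalise (e G (S̄' ω)) K̄

  Λ : ℚ × ℚ → ℚ × ℚ
  Λ (a , b) =
    ((ℕ→ℚ (n ℕ.+ k̄ ℕ.∸ 1) * a + ℕ→ℚ (k ℕ.∸ 1) * b) ÷ℕ (k ℕ.* k̄)) ,
    ((ℕ→ℚ (k̄ ℕ.∸ 1) * a + ℕ→ℚ (n ℕ.+ k ℕ.∸ 1) * b) ÷ℕ (k ℕ.* k̄))

  -- E[ 𝐖' - 𝐖 | 𝐖 ] = -Λ 𝐖, stated (as the definition of conditional
  -- expectation on a finite probability space) via: for every value w,
  -- E[(𝐖'-𝐖)_i · 1{𝐖 = w}] = (-Λ w)_i · P(𝐖 = w), for i = 1,2.
  CondExpClaim : Set
  CondExpClaim = ∀ (w : ℚ × ℚ) →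
    (𝔼 n k k̄ (λ ω → (proj₁ (𝐖' ω) - proj₁ (𝐖 ω)) * 𝟙 (eqℚ² (𝐖 ω) w))
       ≡ (- proj₁ (Λ w)) * 𝔼 n k k̄ (λ ω → 𝟙 (eqℚ² (𝐖 ω) w)))
    × (𝔼 n k k̄ (λ ω → (proj₂ (𝐖' ω) - proj₂ (𝐖 ω)) * 𝟙 (eqℚ² (𝐖 ω) w))
       ≡ (- proj₂ (Λ w)) * 𝔼 n k k̄ (λ ω → 𝟙 (eqℚ² (𝐖 ω) w)))

module Submission where

-- Fix the k-set S. Of the k k̄ swaps (x , x̄), an edge inside S survives in S' for (k - 2) k̄ of them, an edge
-- between S and S̄ ends up inside S' for k - 1 of them, and an edge inside S̄ for none, so
-- Σ e(S') = (k - 2) k̄ e(S) + (k - 1) (M - e(S) - e(S̄)). Recentring with the binomial identity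
-- (n + k̄ - 1) K + (k - 1) K̄ = (k - 1) N turns the average of W' - W over the swaps into -(Λ 𝐖)₁, and as 𝐖 is
-- a function of S this is also the conditional expectation given 𝐖. The second coordinate is the first one
-- for S̄, with the roles of x and x̄ exchanged.

open import Defs hiding (sym)

module Combinatorics where

  open import Data.Nat using (ℕ; zero; suc; _+_; _*_; _<ᵇ_; NonZero)
  open import Data.Nat.Properties
    using (+-*-semiring; +-identityʳ; +-suc; +-assoc; *-distribʳ-+; *-identityˡ; *-identityʳ; *-zeroʳ; *-assoc;
           *-cancelˡ-≡; <-irrefl; <ᵇ⇒<)
  import Data.Nat.Tactic.RingSolver as ℕ-Solver
  open import Data.Nat.Combinatorics using (_C_; nC1≡n; nCk+nC[k+1]≡[n+1]C[k+1])
  open import Data.Nat.ListAction using () renaming (sum to sumₗ)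
  open import Data.Nat.ListAction.Properties using (sum-++)
  open import Data.Bool using (Bool; true; false; not; _∧_; _∨_; _xor_; if_then_else_; T)
  open import Data.Bool.Properties using (∨-identityʳ; not-involutive)
  open import Data.Fin using (Fin; zero; suc; toℕ; _≟_)
  open import Data.Fin.Subset using (Subset; ⁅_⁆; _∪_; _─_; ∁; ∣_∣) renaming (_-_ to _∖ᵥ_)
  open import Data.Vec using ([]; _∷_; lookup; replicate)
  open import Data.Vec.Properties using (lookup-map; lookup-replicate; lookup-zipWith)
  open import Data.List using (List; []; _∷_; _++_; map; tabulate; allFin; filterᵇ; cartesianProduct; length)
  open import Data.List.Properties using (map-tabulate; map-++; map-∘; map-cong)
  open import Data.Product using (_×_; _,_)
  open import Function using (_∘_)
  open import Relation.Nullary using (does; yes; no; contradiction)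
  open import Relation.Binary.PropositionalEquality
  open import Algebra.Properties.Semiring.Sum +-*-semiring
    using (sum-syntax; ∑-distrib-+; ∑-comm; *-distribˡ-sum; *-distribʳ-sum; sum-cong-≗; sum-replicate-zero)
  open ≡-Reasoning

  ⟦_⟧ : Bool → ℕ
  ⟦ true ⟧  = 1
  ⟦ false ⟧ = 0

  ⟦∧⟧ : ∀ a b → ⟦ a ∧ b ⟧ ≡ ⟦ a ⟧ * ⟦ b ⟧
  ⟦∧⟧ true  b = sym (+-identityʳ ⟦ b ⟧)
  ⟦∧⟧ false b = refl

  _≡ᵇ_ : ∀ {n} → Fin n → Fin n → Bool
  i ≡ᵇ j = does (i ≟ j)

  ≢⇒≡ᵇ-false : ∀ {n} {i j : Fin n} → i ≢ j → i ≡ᵇ j ≡ false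
  ≢⇒≡ᵇ-false {i = i} {j} i≢j with i ≟ j
  ... | yes i≡j = contradiction i≡j i≢j
  ... | no _    = refl

  count : ∀ {n} → (Fin n → Bool) → ℕ
  count {n} u = ∑[ i < n ] ⟦ u i ⟧

  ∑-δ : ∀ {n} (j : Fin n) (f : Fin n → ℕ) → ∑[ z < n ] (⟦ z ≡ᵇ j ⟧ * f z) ≡ f j
  ∑-δ {suc n} zero    f = trans (cong₂ _+_ (+-identityʳ (f zero)) (sum-replicate-zero n)) (+-identityʳ (f zero))
  ∑-δ {suc n} (suc j) f = ∑-δ j (f ∘ suc)

  ∑-split-at : ∀ {n} (i : Fin n) (f : Fin n → ℕ) →
    ∑[ y < n ] f y ≡ ∑[ y < n ] (⟦ not (y ≡ᵇ i) ⟧ * f y) + f i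
  ∑-split-at {n} i f = begin
    ∑[ y < n ] f y
      ≡⟨ sum-cong-≗ split ⟩
    ∑[ y < n ] (g y + ⟦ y ≡ᵇ i ⟧ * f y)
      ≡⟨ ∑-distrib-+ g (λ y → ⟦ y ≡ᵇ i ⟧ * f y) ⟩
    ∑[ y < n ] g y + ∑[ y < n ] (⟦ y ≡ᵇ i ⟧ * f y)
      ≡⟨ cong (∑[ y < n ] g y +_) (∑-δ i f) ⟩
    ∑[ y < n ] g y + f i ∎
    where
    g : Fin n → ℕ
    g y = ⟦ not (y ≡ᵇ i) ⟧ * f y
    split : ∀ y → f y ≡ g y + ⟦ y ≡ᵇ i ⟧ * f y
    split y with y ≡ᵇ i
    ... | true  = sym (+-identityʳ (f y))
    ... | false = sym (trans (+-identityʳ _) (+-identityʳ (f y)))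

  ∑∑-factor : ∀ {n} {F : Fin n → Fin n → ℕ} (f g : Fin n → ℕ) → (∀ y z → F y z ≡ f y * g z) →
    ∑[ y < n ] ∑[ z < n ] F y z ≡ (∑[ y < n ] f y) * (∑[ z < n ] g z)
  ∑∑-factor {n} f g F≡fg = begin
    ∑[ y < n ] ∑[ z < n ] _         ≡⟨ sum-cong-≗ (λ y → sum-cong-≗ (F≡fg y)) ⟩
    ∑[ y < n ] ∑[ z < n ] (f y * g z) ≡⟨ sum-cong-≗ (λ y → sym (*-distribˡ-sum (f y) g)) ⟩
    ∑[ y < n ] (f y * ∑[ z < n ] g z) ≡⟨ sym (*-distribʳ-sum (∑[ z < n ] g z) f) ⟩
    (∑[ y < n ] f y) * (∑[ z < n ] g z) ∎

  ∑∑-distrib-+ : ∀ {n} (F H : Fin n → Fin n → ℕ) →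
    ∑[ i < n ] ∑[ j < n ] (F i j + H i j) ≡ ∑[ i < n ] ∑[ j < n ] F i j + ∑[ i < n ] ∑[ j < n ] H i j
  ∑∑-distrib-+ {n} F H =
    trans (sum-cong-≗ (λ i → ∑-distrib-+ (F i) (H i))) (∑-distrib-+ (λ i → ∑[ j < n ] F i j) (λ i → ∑[ j < n ] H i j))

  ∑∑-*-distribˡ : ∀ {n} c (F : Fin n → Fin n → ℕ) →
    c * ∑[ i < n ] ∑[ j < n ] F i j ≡ ∑[ i < n ] ∑[ j < n ] (c * F i j)
  ∑∑-*-distribˡ {n} c F = trans (*-distribˡ-sum c (λ i → ∑[ j < n ] F i j)) (sum-cong-≗ λ i → *-distribˡ-sum c (F i))

  ∑∑∑∑-comm : ∀ {n} (F : Fin n → Fin n → Fin n → Fin n → ℕ) →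
    ∑[ y < n ] ∑[ z < n ] ∑[ i < n ] ∑[ j < n ] F y z i j ≡ ∑[ i < n ] ∑[ j < n ] ∑[ y < n ] ∑[ z < n ] F y z i j
  ∑∑∑∑-comm {n} F = begin
    ∑[ y < n ] ∑[ z < n ] ∑[ i < n ] ∑[ j < n ] F y z i j
      ≡⟨ sum-cong-≗ (λ y → ∑-comm λ z i → ∑[ j < n ] F y z i j) ⟩
    ∑[ y < n ] ∑[ i < n ] ∑[ z < n ] ∑[ j < n ] F y z i j
      ≡⟨ ∑-comm (λ y i → ∑[ z < n ] ∑[ j < n ] F y z i j) ⟩
    ∑[ i < n ] ∑[ y < n ] ∑[ z < n ] ∑[ j < n ] F y z i j
      ≡⟨ sum-cong-≗ (λ i → sum-cong-≗ λ y → ∑-comm λ z j → F y z i j) ⟩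
    ∑[ i < n ] ∑[ y < n ] ∑[ j < n ] ∑[ z < n ] F y z i j
      ≡⟨ sum-cong-≗ (λ i → ∑-comm λ y j → ∑[ z < n ] F y z i j) ⟩
    ∑[ i < n ] ∑[ j < n ] ∑[ y < n ] ∑[ z < n ] F y z i j ∎

  count-∁ : ∀ {n} (u : Fin n → Bool) → count u + count (not ∘ u) ≡ n
  count-∁ {zero}  u = refl
  count-∁ {suc n} u with u zero
  ... | true  = cong suc (count-∁ (u ∘ suc))
  ... | false = trans (+-suc (count (u ∘ suc)) _) (cong suc (count-∁ (u ∘ suc)))

  sumₗ-tabulate : ∀ {n} (f : Fin n → ℕ) → sumₗ (tabulate f) ≡ ∑[ i < n ] f i
  sumₗ-tabulate {zero}  f = refl
  sumₗ-tabulate {suc n} f = cong (f zero +_) (sumₗ-tabulate (f ∘ suc))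

  sumₗ-allFin : ∀ {n} (f : Fin n → ℕ) → sumₗ (map f (allFin n)) ≡ ∑[ i < n ] f i
  sumₗ-allFin f = trans (cong sumₗ (map-tabulate (λ i → i) f)) (sumₗ-tabulate f)

  sumₗ-filterᵇ : ∀ {A : Set} (p : A → Bool) (f : A → ℕ) xs →
    sumₗ (map f (filterᵇ p xs)) ≡ sumₗ (map (λ x → ⟦ p x ⟧ * f x) xs)
  sumₗ-filterᵇ p f []       = refl
  sumₗ-filterᵇ p f (x ∷ xs) with p x
  ... | true  = cong₂ _+_ (sym (+-identityʳ (f x))) (sumₗ-filterᵇ p f xs)
  ... | false = sumₗ-filterᵇ p f xs

  sumₗ-filterᵇ-allFin : ∀ {n} (p : Fin n → Bool) (f : Fin n → ℕ) →
    sumₗ (map f (filterᵇ p (allFin n))) ≡ ∑[ i < n ] (⟦ p i ⟧ * f i)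
  sumₗ-filterᵇ-allFin {n} p f = trans (sumₗ-filterᵇ p f (allFin n)) (sumₗ-allFin (λ i → ⟦ p i ⟧ * f i))

  sumₗ-cartesianProduct : ∀ {A B : Set} (f : A × B → ℕ) xs (ys : List B) →
    sumₗ (map f (cartesianProduct xs ys)) ≡ sumₗ (map (λ x → sumₗ (map (λ y → f (x , y)) ys)) xs)
  sumₗ-cartesianProduct f []       ys = refl
  sumₗ-cartesianProduct f (x ∷ xs) ys = begin
    sumₗ (map f (map (x ,_) ys ++ cartesianProduct xs ys))
      ≡⟨ cong sumₗ (map-++ f (map (x ,_) ys) _) ⟩
    sumₗ (map f (map (x ,_) ys) ++ map f (cartesianProduct xs ys))
      ≡⟨ sum-++ (map f (map (x ,_) ys)) _ ⟩
    sumₗ (map f (map (x ,_) ys)) + sumₗ (map f (cartesianProduct xs ys))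
      ≡⟨ cong₂ _+_ (cong sumₗ (sym (map-∘ ys))) (sumₗ-cartesianProduct f xs ys) ⟩
    sumₗ (map (λ y → f (x , y)) ys) + sumₗ (map (λ x → sumₗ (map (λ y → f (x , y)) ys)) xs) ∎

  length-filterᵇ-allFin : ∀ {n} (p : Fin n → Bool) → length (filterᵇ p (allFin n)) ≡ count p
  length-filterᵇ-allFin {n} p = begin
    length (filterᵇ p (allFin n))                  ≡⟨ length≡sumₗ-1 (filterᵇ p (allFin n)) ⟩
    sumₗ (map (λ _ → 1) (filterᵇ p (allFin n)))   ≡⟨ sumₗ-filterᵇ-allFin p (λ _ → 1) ⟩
    ∑[ i < n ] (⟦ p i ⟧ * 1)                       ≡⟨ sum-cong-≗ (λ i → *-identityʳ ⟦ p i ⟧) ⟩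
    count p                                        ∎
    where
    length≡sumₗ-1 : ∀ {A : Set} (xs : List A) → length xs ≡ sumₗ (map (λ _ → 1) xs)
    length≡sumₗ-1 []       = refl
    length≡sumₗ-1 (x ∷ xs) = cong suc (length≡sumₗ-1 xs)

  ∣∣≡count : ∀ {n} (p : Subset n) → ∣ p ∣ ≡ count (lookup p)
  ∣∣≡count []          = refl
  ∣∣≡count (true ∷ p)  = cong suc (∣∣≡count p)
  ∣∣≡count (false ∷ p) = ∣∣≡count p

  lookup-⁅⁆ : ∀ {n} (z i : Fin n) → lookup ⁅ z ⁆ i ≡ z ≡ᵇ i
  lookup-⁅⁆ zero    zero    = refl
  lookup-⁅⁆ zero    (suc i) = lookup-replicate i false
  lookup-⁅⁆ (suc z) zero    = refl
  lookup-⁅⁆ (suc z) (suc i) = lookup-⁅⁆ z i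

  lookup-─ : ∀ {n} (p q : Subset n) i → lookup (p ─ q) i ≡ lookup p i ∧ not (lookup q i)
  lookup-─ (true  ∷ p) (true  ∷ q) zero    = refl
  lookup-─ (false ∷ p) (true  ∷ q) zero    = refl
  lookup-─ (true  ∷ p) (false ∷ q) zero    = refl
  lookup-─ (false ∷ p) (false ∷ q) zero    = refl
  lookup-─ (b     ∷ p) (c     ∷ q) (suc i) = lookup-─ p q i

  lookup-∖ᵥ : ∀ {n} (p : Subset n) (y i : Fin n) → lookup (p ∖ᵥ y) i ≡ lookup p i ∧ not (y ≡ᵇ i)
  lookup-∖ᵥ p y i = trans (lookup-─ p ⁅ y ⁆ i) (cong (λ b → lookup p i ∧ not b) (lookup-⁅⁆ y i))

  swapped : ∀ {n} → Subset n → Fin n → Fin n → Subset n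
  swapped V y z = (V ∖ᵥ y) ∪ ⁅ z ⁆

  lookup-swapped : ∀ {n} (V : Subset n) (y z i : Fin n) →
    lookup (swapped V y z) i ≡ (lookup V i ∧ not (y ≡ᵇ i)) ∨ z ≡ᵇ i
  lookup-swapped V y z i =
    trans (lookup-zipWith _∨_ i (V ∖ᵥ y) ⁅ z ⁆) (cong₂ _∨_ (lookup-∖ᵥ V y i) (lookup-⁅⁆ z i))

  lookup-swapped-inout : ∀ {n} (V : Subset n) {y z : Fin n} → lookup V y ≡ true → lookup V z ≡ false →
    ∀ i → lookup (swapped V y z) i ≡ (if lookup V i then not (y ≡ᵇ i) else z ≡ᵇ i)
  lookup-swapped-inout V {y} {z} Vy Vz i rewrite lookup-swapped V y z i with lookup V i in Vi
  ... | false = refl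
  ... | true with z ≟ i
  ...   | yes refl = contradiction (trans (sym Vz) Vi) λ ()
  ...   | no _     = ∨-identityʳ _

  ∁-involutive : ∀ {n} (S : Subset n) → ∁ (∁ S) ≡ S
  ∁-involutive []      = refl
  ∁-involutive (b ∷ S) = cong₂ _∷_ (not-involutive b) (∁-involutive S)

  ∑∁-reindex : ∀ {n} (S : Subset n) (F : Fin n → Fin n → ℕ) →
    ∑[ x < n ] (⟦ lookup S x ⟧ * ∑[ x̄ < n ] (⟦ not (lookup S x̄) ⟧ * F x̄ x))
    ≡ ∑[ y < n ] (⟦ lookup (∁ S) y ⟧ * ∑[ z < n ] (⟦ not (lookup (∁ S) z) ⟧ * F y z))
  ∑∁-reindex {n} S F = begin
    ∑[ x < n ] (⟦ lookup S x ⟧ * ∑[ x̄ < n ] (⟦ not (lookup S x̄) ⟧ * F x̄ x))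
      ≡⟨ sum-cong-≗ (λ x → *-distribˡ-sum ⟦ lookup S x ⟧ λ x̄ → ⟦ not (lookup S x̄) ⟧ * F x̄ x) ⟩
    ∑[ x < n ] ∑[ x̄ < n ] (⟦ lookup S x ⟧ * (⟦ not (lookup S x̄) ⟧ * F x̄ x))
      ≡⟨ ∑-comm (λ x x̄ → ⟦ lookup S x ⟧ * (⟦ not (lookup S x̄) ⟧ * F x̄ x)) ⟩
    ∑[ x̄ < n ] ∑[ x < n ] (⟦ lookup S x ⟧ * (⟦ not (lookup S x̄) ⟧ * F x̄ x))
      ≡⟨ sum-cong-≗ (λ x̄ → sum-cong-≗ λ x → swap-factors ⟦ lookup S x ⟧ ⟦ not (lookup S x̄) ⟧ (F x̄ x)) ⟩
    ∑[ x̄ < n ] ∑[ x < n ] (⟦ not (lookup S x̄) ⟧ * (⟦ lookup S x ⟧ * F x̄ x))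
      ≡⟨ sum-cong-≗ (λ x̄ → *-distribˡ-sum ⟦ not (lookup S x̄) ⟧ λ x → ⟦ lookup S x ⟧ * F x̄ x) ⟨
    ∑[ x̄ < n ] (⟦ not (lookup S x̄) ⟧ * ∑[ x < n ] (⟦ lookup S x ⟧ * F x̄ x))
      ≡⟨ sum-cong-≗ (λ y → cong₂ (λ b c → ⟦ b ⟧ * c) (sym (lookup-map y not S))
           (sum-cong-≗ λ z → cong (λ b → ⟦ b ⟧ * F y z)
             (trans (sym (not-involutive _)) (cong not (sym (lookup-map z not S)))))) ⟩
    ∑[ y < n ] (⟦ lookup (∁ S) y ⟧ * ∑[ z < n ] (⟦ not (lookup (∁ S) z) ⟧ * F y z)) ∎
    where
    swap-factors : ∀ a b c → a * (b * c) ≡ b * (a * c)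
    swap-factors = ℕ-Solver.solve-∀

  module EdgeCounts {n : ℕ} (G : Graph n) where

    edgeAt : Fin n → Fin n → ℕ
    edgeAt i j = ⟦ (toℕ i <ᵇ toℕ j) ∧ adj G i j ⟧

    inside : (Fin n → Bool) → ℕ
    inside u = ∑[ i < n ] ∑[ j < n ] (edgeAt i j * ⟦ u i ∧ u j ⟧)

    crossing : (Fin n → Bool) → ℕ
    crossing u = ∑[ i < n ] ∑[ j < n ] (edgeAt i j * ⟦ u i xor u j ⟧)

    e≡inside : ∀ U → e G U ≡ inside (lookup U)
    e≡inside U = begin
      e G U
        ≡⟨ sumₗ-cartesianProduct f (allFin n) (allFin n) ⟩
      sumₗ (map (λ i → sumₗ (map (λ j → f (i , j)) (allFin n))) (allFin n))
        ≡⟨ cong sumₗ (map-cong (λ i → sumₗ-allFin (λ j → f (i , j))) (allFin n)) ⟩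
      sumₗ (map (λ i → ∑[ j < n ] f (i , j)) (allFin n))
        ≡⟨ sumₗ-allFin (λ i → ∑[ j < n ] f (i , j)) ⟩
      ∑[ i < n ] ∑[ j < n ] f (i , j)
        ≡⟨ sum-cong-≗ (λ i → sum-cong-≗ λ j → rearrange (toℕ i <ᵇ toℕ j) (lookup U i) (lookup U j) (adj G i j)) ⟩
      inside (lookup U) ∎
      where
      f : Fin n × Fin n → ℕ
      f (i , j) = if (toℕ i <ᵇ toℕ j) ∧ lookup U i ∧ lookup U j ∧ adj G i j then 1 else 0
      rearrange : ∀ l a b c → (if l ∧ a ∧ b ∧ c then 1 else 0) ≡ ⟦ l ∧ c ⟧ * ⟦ a ∧ b ⟧
      rearrange false a     b     c     = refl
      rearrange true  false b     c     = sym (*-zeroʳ ⟦ c ⟧)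
      rearrange true  true  false c     = sym (*-zeroʳ ⟦ c ⟧)
      rearrange true  true  true  false = refl
      rearrange true  true  true  true  = refl

    inside+inside+crossing : ∀ u → inside u + inside (not ∘ u) + crossing u ≡ edges G
    inside+inside+crossing u = begin
      inside u + inside (not ∘ u) + crossing u
        ≡⟨ cong (_+ crossing u) (sym (∑∑-distrib-+ F₁ F₂)) ⟩
      ∑[ i < n ] ∑[ j < n ] (F₁ i j + F₂ i j) + crossing u
        ≡⟨ sym (∑∑-distrib-+ (λ i j → F₁ i j + F₂ i j) F₃) ⟩
      ∑[ i < n ] ∑[ j < n ] (F₁ i j + F₂ i j + F₃ i j)
        ≡⟨ sum-cong-≗ (λ i → sum-cong-≗ λ j → partition (edgeAt i j) (u i) (u j)) ⟩
      inside (λ _ → true)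
        ≡⟨ sum-cong-≗ (λ i → sum-cong-≗ λ j →
             cong₂ (λ a b → edgeAt i j * ⟦ a ∧ b ⟧) (lookup-replicate i true) (lookup-replicate j true)) ⟨
      inside (lookup (replicate n true))
        ≡⟨ e≡inside (replicate n true) ⟨
      edges G ∎
      where
      F₁ F₂ F₃ : Fin n → Fin n → ℕ
      F₁ i j = edgeAt i j * ⟦ u i ∧ u j ⟧
      F₂ i j = edgeAt i j * ⟦ not (u i) ∧ not (u j) ⟧
      F₃ i j = edgeAt i j * ⟦ u i xor u j ⟧
      partition : ∀ x a b → x * ⟦ a ∧ b ⟧ + x * ⟦ not a ∧ not b ⟧ + x * ⟦ a xor b ⟧ ≡ x * 1
      partition x true  true  rewrite *-zeroʳ x = trans (+-identityʳ _) (+-identityʳ _)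
      partition x true  false rewrite *-zeroʳ x = refl
      partition x false true  rewrite *-zeroʳ x = refl
      partition x false false rewrite *-zeroʳ x = +-identityʳ _

    e-∁ : ∀ V → e G (∁ V) ≡ inside (not ∘ lookup V)
    e-∁ V = trans (e≡inside (∁ V)) (sum-cong-≗ λ i → sum-cong-≗ λ j →
      cong₂ (λ x y → edgeAt i j * ⟦ x ∧ y ⟧) (lookup-map i not V) (lookup-map j not V))

  module Swaps {n : ℕ} (V : Subset n) where

    t t̄ : ℕ
    t = count (lookup V)
    t̄ = count (not ∘ lookup V)

    swapsKeeping : Fin n → Fin n → ℕ
    swapsKeeping i j = ∑[ y < n ] ∑[ z < n ]
      (⟦ lookup V y ⟧ * ⟦ not (lookup V z) ⟧ * ⟦ lookup (swapped V y z) i ∧ lookup (swapped V y z) j ⟧)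

    private
      stays : Bool → Fin n → Fin n → Fin n → Bool
      stays b y z i = if b then not (y ≡ᵇ i) else z ≡ᵇ i

      keeping : Bool → Bool → Fin n → Fin n → ℕ
      keeping bᵢ bⱼ i j = ∑[ y < n ] ∑[ z < n ]
        (⟦ lookup V y ⟧ * ⟦ not (lookup V z) ⟧ * (⟦ stays bᵢ y z i ⟧ * ⟦ stays bⱼ y z j ⟧))

      swapsKeeping≡keeping : ∀ i j → swapsKeeping i j ≡ keeping (lookup V i) (lookup V j) i j
      swapsKeeping≡keeping i j = sum-cong-≗ λ y → sum-cong-≗ λ z → pointwise y z
        where
        pointwise : ∀ y z →
          ⟦ lookup V y ⟧ * ⟦ not (lookup V z) ⟧ * ⟦ lookup (swapped V y z) i ∧ lookup (swapped V y z) j ⟧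
          ≡ ⟦ lookup V y ⟧ * ⟦ not (lookup V z) ⟧ * (⟦ stays (lookup V i) y z i ⟧ * ⟦ stays (lookup V j) y z j ⟧)
        pointwise y z with lookup V y in Vy | lookup V z in Vz
        ... | true  | false = cong (1 * 1 *_) (trans
              (cong₂ (λ a b → ⟦ a ∧ b ⟧) (lookup-swapped-inout V Vy Vz i) (lookup-swapped-inout V Vy Vz j))
              (⟦∧⟧ (stays (lookup V i) y z i) (stays (lookup V j) y z j)))
        ... | true  | true  = refl
        ... | false | _     = refl

      count-without : ∀ i → lookup V i ≡ true → t ≡ ∑[ y < n ] (⟦ not (y ≡ᵇ i) ⟧ * ⟦ lookup V y ⟧) + 1
      count-without i Vi = trans (∑-split-at i (λ y → ⟦ lookup V y ⟧))
        (cong (λ b → ∑[ y < n ] (⟦ not (y ≡ᵇ i) ⟧ * ⟦ lookup V y ⟧) + ⟦ b ⟧) Vi)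

      keeping-in-in : ∀ {i j} → i ≢ j → lookup V i ≡ true → lookup V j ≡ true →
        keeping true true i j + 2 * t̄ ≡ t * t̄
      keeping-in-in {i} {j} i≢j Vi Vj = begin
        keeping true true i j + 2 * t̄
          ≡⟨ cong (_+ 2 * t̄) (∑∑-factor (λ y → ⟦ not (y ≡ᵇ j) ⟧ * (⟦ not (y ≡ᵇ i) ⟧ * ⟦ lookup V y ⟧))
               (λ z → ⟦ not (lookup V z) ⟧)
               λ y z → reorder ⟦ lookup V y ⟧ ⟦ not (lookup V z) ⟧ ⟦ not (y ≡ᵇ i) ⟧ ⟦ not (y ≡ᵇ j) ⟧) ⟩
        r * t̄ + 2 * t̄
          ≡⟨ *-distribʳ-+ t̄ r 2 ⟨
        (r + 2) * t̄
          ≡⟨ cong (_* t̄) t≡r+2 ⟨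
        t * t̄ ∎
        where
        r : ℕ
        r = ∑[ y < n ] (⟦ not (y ≡ᵇ j) ⟧ * (⟦ not (y ≡ᵇ i) ⟧ * ⟦ lookup V y ⟧))
        reorder : ∀ a b c d → a * b * (c * d) ≡ d * (c * a) * b
        reorder = ℕ-Solver.solve-∀
        t≡r+2 : t ≡ r + 2
        t≡r+2 = trans (count-without i Vi) (trans (cong (_+ 1) (trans (∑-split-at j _)
          (cong₂ (λ b c → r + ⟦ not b ⟧ * ⟦ c ⟧) (≢⇒≡ᵇ-false (i≢j ∘ sym)) Vj))) (+-assoc r 1 1))

      keeping-in-out : ∀ {i j} → lookup V i ≡ true → lookup V j ≡ false → keeping true false i j + 1 ≡ t
      keeping-in-out {i} {j} Vi Vj = begin
        keeping true false i j + 1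
          ≡⟨ cong (_+ 1) (∑∑-factor (λ y → ⟦ not (y ≡ᵇ i) ⟧ * ⟦ lookup V y ⟧)
               (λ z → ⟦ z ≡ᵇ j ⟧ * ⟦ not (lookup V z) ⟧)
               λ y z → reorder ⟦ lookup V y ⟧ ⟦ not (lookup V z) ⟧ ⟦ not (y ≡ᵇ i) ⟧ ⟦ z ≡ᵇ j ⟧) ⟩
        r * ∑[ z < n ] (⟦ z ≡ᵇ j ⟧ * ⟦ not (lookup V z) ⟧) + 1
          ≡⟨ cong (λ m → r * m + 1) (trans (∑-δ j _) (cong (λ b → ⟦ not b ⟧) Vj)) ⟩
        r * 1 + 1
          ≡⟨ trans (cong (_+ 1) (*-identityʳ r)) (sym (count-without i Vi)) ⟩
        t ∎
        where
        r : ℕ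
        r = ∑[ y < n ] (⟦ not (y ≡ᵇ i) ⟧ * ⟦ lookup V y ⟧)
        reorder : ∀ a b c d → a * b * (c * d) ≡ c * a * (d * b)
        reorder = ℕ-Solver.solve-∀

      keeping-out-in : ∀ {i j} → lookup V i ≡ false → lookup V j ≡ true → keeping false true i j + 1 ≡ t
      keeping-out-in {i} {j} Vi Vj = begin
        keeping false true i j + 1
          ≡⟨ cong (_+ 1) (∑∑-factor (λ y → ⟦ not (y ≡ᵇ j) ⟧ * ⟦ lookup V y ⟧)
               (λ z → ⟦ z ≡ᵇ i ⟧ * ⟦ not (lookup V z) ⟧)
               λ y z → reorder ⟦ lookup V y ⟧ ⟦ not (lookup V z) ⟧ ⟦ z ≡ᵇ i ⟧ ⟦ not (y ≡ᵇ j) ⟧) ⟩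
        r * ∑[ z < n ] (⟦ z ≡ᵇ i ⟧ * ⟦ not (lookup V z) ⟧) + 1
          ≡⟨ cong (λ m → r * m + 1) (trans (∑-δ i _) (cong (λ b → ⟦ not b ⟧) Vi)) ⟩
        r * 1 + 1
          ≡⟨ trans (cong (_+ 1) (*-identityʳ r)) (sym (count-without j Vj)) ⟩
        t ∎
        where
        r : ℕ
        r = ∑[ y < n ] (⟦ not (y ≡ᵇ j) ⟧ * ⟦ lookup V y ⟧)
        reorder : ∀ a b c d → a * b * (c * d) ≡ d * a * (c * b)
        reorder = ℕ-Solver.solve-∀

      keeping-out-out : ∀ {i j} → i ≢ j → keeping false false i j ≡ 0
      keeping-out-out {i} {j} i≢j = begin
        keeping false false i j
          ≡⟨ ∑∑-factor (λ y → ⟦ lookup V y ⟧) (λ z → ⟦ z ≡ᵇ i ⟧ * (⟦ z ≡ᵇ j ⟧ * ⟦ not (lookup V z) ⟧))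
               (λ y z → reorder ⟦ lookup V y ⟧ ⟦ not (lookup V z) ⟧ ⟦ z ≡ᵇ i ⟧ ⟦ z ≡ᵇ j ⟧) ⟩
        t * ∑[ z < n ] (⟦ z ≡ᵇ i ⟧ * (⟦ z ≡ᵇ j ⟧ * ⟦ not (lookup V z) ⟧))
          ≡⟨ cong (t *_) (trans (∑-δ i _) (cong (λ b → ⟦ b ⟧ * ⟦ not (lookup V i) ⟧) (≢⇒≡ᵇ-false i≢j))) ⟩
        t * 0
          ≡⟨ *-zeroʳ t ⟩
        0 ∎
        where
        reorder : ∀ a b c d → a * b * (c * d) ≡ a * (c * (d * b))
        reorder = ℕ-Solver.solve-∀

      one-side : ∀ {K} → K + 1 ≡ t → K + 2 * t̄ * 0 + 1 ≡ t * t̄ * 0 + t * 1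
      one-side {K} h = trans (drop-zeros K t̄) (trans h (add-zeros t t̄))
        where
        drop-zeros : ∀ K s → K + 2 * s * 0 + 1 ≡ K + 1
        drop-zeros = ℕ-Solver.solve-∀
        add-zeros : ∀ r s → r ≡ r * s * 0 + r * 1
        add-zeros = ℕ-Solver.solve-∀

    -- An edge ij inside V survives (t - 2) t̄ swaps, a crossing one t - 1 and an outside one none; both
    -- sides are shifted so that (t - 2) needs no truncated subtraction.
    swapsKeeping-count : ∀ {i j} → i ≢ j →
      let a = ⟦ lookup V i ∧ lookup V j ⟧ ; c = ⟦ lookup V i xor lookup V j ⟧ in
      swapsKeeping i j + 2 * t̄ * a + c ≡ t * t̄ * a + t * c
    swapsKeeping-count {i} {j} i≢j rewrite swapsKeeping≡keeping i j with lookup V i in Vi | lookup V j in Vj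
    ... | true  | true  = trans (drop-units (keeping true true i j) t̄) (trans (keeping-in-in i≢j Vi Vj) (add-units t t̄))
      where
      drop-units : ∀ K s → K + 2 * s * 1 + 0 ≡ K + 2 * s
      drop-units = ℕ-Solver.solve-∀
      add-units : ∀ r s → r * s ≡ r * s * 1 + r * 0
      add-units = ℕ-Solver.solve-∀
    ... | true  | false = one-side (keeping-in-out Vi Vj)
    ... | false | true  = one-side (keeping-out-in Vi Vj)
    ... | false | false = begin
      keeping false false i j + 2 * t̄ * 0 + 0 ≡⟨ cong (λ K → K + 2 * t̄ * 0 + 0) (keeping-out-out i≢j) ⟩
      2 * t̄ * 0 + 0                           ≡⟨ no-pair t t̄ ⟩
      t * t̄ * 0 + t * 0                        ∎
      where
      no-pair : ∀ r s → 2 * s * 0 + 0 ≡ r * s * 0 + r * 0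
      no-pair = ℕ-Solver.solve-∀

  module SwapSum {n : ℕ} (G : Graph n) (V : Subset n) where
    open EdgeCounts G
    open Swaps V

    swapSum : ℕ
    swapSum = ∑[ y < n ] (⟦ lookup V y ⟧ * ∑[ z < n ] (⟦ not (lookup V z) ⟧ * e G (swapped V y z)))

    swapSum≡∑edgeAt*swapsKeeping : swapSum ≡ ∑[ i < n ] ∑[ j < n ] (edgeAt i j * swapsKeeping i j)
    swapSum≡∑edgeAt*swapsKeeping = begin
      swapSum
        ≡⟨ sum-cong-≗ (λ y → *-distribˡ-sum ⟦ lookup V y ⟧ λ z → ⟦ not (lookup V z) ⟧ * e G (swapped V y z)) ⟩
      ∑[ y < n ] ∑[ z < n ] (⟦ lookup V y ⟧ * (⟦ not (lookup V z) ⟧ * e G (swapped V y z)))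
        ≡⟨ sum-cong-≗ (λ y → sum-cong-≗ λ z → trans (sym (*-assoc ⟦ lookup V y ⟧ _ _))
             (trans (cong (w y z *_) (e≡inside (swapped V y z))) (∑∑-*-distribˡ (w y z) λ i j → edgeAt i j * ⟦ both y z i j ⟧))) ⟩
      ∑[ y < n ] ∑[ z < n ] ∑[ i < n ] ∑[ j < n ] (w y z * (edgeAt i j * ⟦ both y z i j ⟧))
        ≡⟨ sum-cong-≗ (λ y → sum-cong-≗ λ z → sum-cong-≗ λ i → sum-cong-≗ λ j →
             reorder (w y z) (edgeAt i j) ⟦ both y z i j ⟧) ⟩
      ∑[ y < n ] ∑[ z < n ] ∑[ i < n ] ∑[ j < n ] (edgeAt i j * (w y z * ⟦ both y z i j ⟧))
        ≡⟨ ∑∑∑∑-comm (λ y z i j → edgeAt i j * (w y z * ⟦ both y z i j ⟧)) ⟩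
      ∑[ i < n ] ∑[ j < n ] ∑[ y < n ] ∑[ z < n ] (edgeAt i j * (w y z * ⟦ both y z i j ⟧))
        ≡⟨ sum-cong-≗ (λ i → sum-cong-≗ λ j → sym (∑∑-*-distribˡ (edgeAt i j) λ y z → w y z * ⟦ both y z i j ⟧)) ⟩
      ∑[ i < n ] ∑[ j < n ] (edgeAt i j * swapsKeeping i j) ∎
      where
      w : Fin n → Fin n → ℕ
      w y z = ⟦ lookup V y ⟧ * ⟦ not (lookup V z) ⟧
      both : Fin n → Fin n → Fin n → Fin n → Bool
      both y z i j = lookup (swapped V y z) i ∧ lookup (swapped V y z) j
      reorder : ∀ a b c → a * (b * c) ≡ b * (a * c)
      reorder = ℕ-Solver.solve-∀

    private
      absent-edge : ∀ K a c s r → 0 * K + 2 * s * (0 * a) + 0 * c ≡ r * s * (0 * a) + r * (0 * c)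
      absent-edge = ℕ-Solver.solve-∀

      present-edge : ∀ K a c s r → K + 2 * s * a + c ≡ r * s * a + r * c →
        1 * K + 2 * s * (1 * a) + 1 * c ≡ r * s * (1 * a) + r * (1 * c)
      present-edge K a c s r h rewrite *-identityˡ K | *-identityˡ a | *-identityˡ c = h

      edge-identity : ∀ i j →
        let E = edgeAt i j ; a = ⟦ lookup V i ∧ lookup V j ⟧ ; c = ⟦ lookup V i xor lookup V j ⟧ in
        E * swapsKeeping i j + 2 * t̄ * (E * a) + E * c ≡ t * t̄ * (E * a) + t * (E * c)
      edge-identity i j with toℕ i <ᵇ toℕ j in i<j | adj G i j
      ... | true  | true  = present-edge (swapsKeeping i j) _ _ t̄ t (swapsKeeping-count i≢j)
        where
        i≢j : i ≢ j
        i≢j refl = <-irrefl refl (<ᵇ⇒< (toℕ i) (toℕ i) (subst T (sym i<j) _))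
      ... | true  | false = absent-edge (swapsKeeping i j) ⟦ lookup V i ∧ lookup V j ⟧ ⟦ lookup V i xor lookup V j ⟧ t̄ t
      ... | false | _     = absent-edge (swapsKeeping i j) ⟦ lookup V i ∧ lookup V j ⟧ ⟦ lookup V i xor lookup V j ⟧ t̄ t

    swapSum-count : let u = lookup V in
      swapSum + 2 * t̄ * inside u + crossing u ≡ t * t̄ * inside u + t * crossing u
    swapSum-count = begin
      swapSum + 2 * t̄ * inside u + crossing u
        ≡⟨ cong₂ (λ x y → x + y + crossing u) swapSum≡∑edgeAt*swapsKeeping (∑∑-*-distribˡ (2 * t̄) F₂) ⟩
      ∑[ i < n ] ∑[ j < n ] F₁ i j + ∑[ i < n ] ∑[ j < n ] (2 * t̄ * F₂ i j) + crossing u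
        ≡⟨ cong (_+ crossing u) (∑∑-distrib-+ F₁ _) ⟨
      ∑[ i < n ] ∑[ j < n ] (F₁ i j + 2 * t̄ * F₂ i j) + crossing u
        ≡⟨ ∑∑-distrib-+ (λ i j → F₁ i j + 2 * t̄ * F₂ i j) F₃ ⟨
      ∑[ i < n ] ∑[ j < n ] (F₁ i j + 2 * t̄ * F₂ i j + F₃ i j)
        ≡⟨ sum-cong-≗ (λ i → sum-cong-≗ (edge-identity i)) ⟩
      ∑[ i < n ] ∑[ j < n ] (t * t̄ * F₂ i j + t * F₃ i j)
        ≡⟨ ∑∑-distrib-+ (λ i j → t * t̄ * F₂ i j) (λ i j → t * F₃ i j) ⟩
      ∑[ i < n ] ∑[ j < n ] (t * t̄ * F₂ i j) + ∑[ i < n ] ∑[ j < n ] (t * F₃ i j)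
        ≡⟨ cong₂ _+_ (∑∑-*-distribˡ (t * t̄) F₂) (∑∑-*-distribˡ t F₃) ⟨
      t * t̄ * inside u + t * crossing u ∎
      where
      u : Fin n → Bool
      u = lookup V
      F₁ F₂ F₃ : Fin n → Fin n → ℕ
      F₁ i j = edgeAt i j * swapsKeeping i j
      F₂ i j = edgeAt i j * ⟦ u i ∧ u j ⟧
      F₃ i j = edgeAt i j * ⟦ u i xor u j ⟧

  2*C2 : ∀ m → 2 * (suc m C 2) ≡ suc m * m
  2*C2 zero    = refl
  2*C2 (suc m) = begin
    2 * (suc (suc m) C 2)       ≡⟨ cong (2 *_) (sym (nCk+nC[k+1]≡[n+1]C[k+1] (suc m) 1)) ⟩
    2 * (suc m C 1 + suc m C 2) ≡⟨ cong (λ c → 2 * (c + suc m C 2)) (nC1≡n (suc m)) ⟩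
    2 * (suc m + suc m C 2)     ≡⟨ distribute m (suc m C 2) ⟩
    2 * suc m + 2 * (suc m C 2) ≡⟨ cong (2 * suc m +_) (2*C2 m) ⟩
    2 * suc m + suc m * m       ≡⟨ collect m ⟩
    suc (suc m) * suc m ∎
    where
    distribute : ∀ m c → 2 * (suc m + c) ≡ 2 * suc m + 2 * c
    distribute = ℕ-Solver.solve-∀
    collect : ∀ m → 2 * suc m + suc m * m ≡ suc (suc m) * suc m
    collect = ℕ-Solver.solve-∀

  binomial-identity : ∀ a b → (a + suc b + suc b) * (suc a C 2) + a * (suc b C 2) ≡ a * ((suc a + suc b) C 2)
  binomial-identity a b = *-cancelˡ-≡ _ _ 2 (begin
    2 * ((a + suc b + suc b) * (suc a C 2) + a * (suc b C 2))
      ≡⟨ pull (a + suc b + suc b) (suc a C 2) a (suc b C 2) ⟩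
    (a + suc b + suc b) * (2 * (suc a C 2)) + a * (2 * (suc b C 2))
      ≡⟨ cong₂ (λ x y → (a + suc b + suc b) * x + a * y) (2*C2 a) (2*C2 b) ⟩
    (a + suc b + suc b) * (suc a * a) + a * (suc b * b)
      ≡⟨ polynomial a b ⟩
    a * (suc (a + suc b) * (a + suc b))
      ≡⟨ cong (a *_) (sym (2*C2 (a + suc b))) ⟩
    a * (2 * (suc (a + suc b) C 2))
      ≡⟨ push a (suc (a + suc b) C 2) ⟩
    2 * (a * ((suc a + suc b) C 2)) ∎)
    where
    pull : ∀ p x q y → 2 * (p * x + q * y) ≡ p * (2 * x) + q * (2 * y)
    pull = ℕ-Solver.solve-∀
    polynomial : ∀ a b → (a + suc b + suc b) * (suc a * a) + a * (suc b * b) ≡ a * (suc (a + suc b) * (a + suc b))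
    polynomial = ℕ-Solver.solve-∀
    push : ∀ a x → a * (2 * x) ≡ 2 * (a * x)
    push = ℕ-Solver.solve-∀

  C2-nonZero : ∀ a b → NonZero ((suc a + suc b) C 2)
  C2-nonZero a b = subst NonZero (sym (trans
    (sym (nCk+nC[k+1]≡[n+1]C[k+1] (a + suc b) 1))
    (cong (_+ (a + suc b) C 2) (trans (nC1≡n (a + suc b)) (+-suc a b))))) _

module Rationals where

  open import Data.Nat as ℕ using (ℕ; zero; suc; NonZero)
  import Data.Integer as ℤ
  import Data.Integer.Properties as ℤ
  open import Data.Rational using (ℚ; 0ℚ; 1ℚ; _+_; _*_; -_; _-_; mkℚ)
  open import Data.Rational.Properties
    using (+-*-commutativeRing; _≟_; +-identityˡ; +-assoc; *-identityˡ; *-zeroʳ; *-distribˡ-+; *-inverseʳ;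
           normalize-coprime; /-cong)
  open import Data.Nat.Coprimality using (1-coprimeTo) renaming (sym to coprime-sym)
  open import Data.Nat.ListAction using () renaming (sum to sumₗ)
  open import Data.Bool using (Bool; true; false)
  open import Data.List using (List; []; _∷_; _++_; map; concatMap; filterᵇ; length)
  open import Data.List.Properties using (map-++)
  open import Data.Product using (_,_)
  open import Algebra.Bundles using (CommutativeRing)
  open import Algebra.Properties.Semiring.Mult (CommutativeRing.semiring +-*-commutativeRing) using (_×_; ×-homo-+; ×1-homo-*)
  open import Tactic.RingSolver using (solve-∀)
  open import Tactic.RingSolver.Core.AlmostCommutativeRing using (AlmostCommutativeRing; fromCommutativeRing)
  open import Relation.Nullary using (yes; no; contradiction)
  open import Relation.Nullary.Decidable using (dec⇒maybe)
  open import Relation.Binary.PropositionalEquality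
  open import Level using (0ℓ)

  ℚ-ring : AlmostCommutativeRing 0ℓ 0ℓ
  ℚ-ring = fromCommutativeRing +-*-commutativeRing (λ q → dec⇒maybe (0ℚ ≟ q))

  ℕ→ℚ-suc : ∀ m → ℕ→ℚ (suc m) ≡ 1ℚ + ℕ→ℚ m
  ℕ→ℚ-suc m = sym (trans
    (cong (λ q → 1ℚ + q) (normalize-coprime (coprime-sym (1-coprimeTo m))))
    (/-cong (cong (λ i → ℤ.1ℤ ℤ.+ i) (ℤ.*-identityʳ (ℤ.+ m))) refl))

  ℕ→ℚ≡×1 : ∀ m → ℕ→ℚ m ≡ m × 1ℚ
  ℕ→ℚ≡×1 zero    = refl
  ℕ→ℚ≡×1 (suc m) = trans (ℕ→ℚ-suc m) (cong (λ q → 1ℚ + q) (ℕ→ℚ≡×1 m))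

  ℕ→ℚ-+ : ∀ a b → ℕ→ℚ (a ℕ.+ b) ≡ ℕ→ℚ a + ℕ→ℚ b
  ℕ→ℚ-+ a b rewrite ℕ→ℚ≡×1 (a ℕ.+ b) | ℕ→ℚ≡×1 a | ℕ→ℚ≡×1 b = ×-homo-+ 1ℚ a b

  ℕ→ℚ-* : ∀ a b → ℕ→ℚ (a ℕ.* b) ≡ ℕ→ℚ a * ℕ→ℚ b
  ℕ→ℚ-* a b rewrite ℕ→ℚ≡×1 (a ℕ.* b) | ℕ→ℚ≡×1 a | ℕ→ℚ≡×1 b = ×1-homo-* a b

  ℕ→ℚ-identity : ∀ D s A C t → D ℕ.+ 2 ℕ.* s ℕ.* A ℕ.+ C ≡ t ℕ.* s ℕ.* A ℕ.+ t ℕ.* C →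
    ℕ→ℚ D + (1ℚ + 1ℚ) * ℕ→ℚ s * ℕ→ℚ A + ℕ→ℚ C ≡ ℕ→ℚ t * ℕ→ℚ s * ℕ→ℚ A + ℕ→ℚ t * ℕ→ℚ C
  ℕ→ℚ-identity D s A C t h = begin
    ℕ→ℚ D + (1ℚ + 1ℚ) * ℕ→ℚ s * ℕ→ℚ A + ℕ→ℚ C
      ≡⟨ trans (ℕ→ℚ-+ (D ℕ.+ 2 ℕ.* s ℕ.* A) C) (cong (_+ ℕ→ℚ C) (trans (ℕ→ℚ-+ D (2 ℕ.* s ℕ.* A))
           (cong (ℕ→ℚ D +_) (trans (ℕ→ℚ-* (2 ℕ.* s) A) (cong (_* ℕ→ℚ A) (ℕ→ℚ-* 2 s)))))) ⟨
    ℕ→ℚ (D ℕ.+ 2 ℕ.* s ℕ.* A ℕ.+ C)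
      ≡⟨ cong ℕ→ℚ h ⟩
    ℕ→ℚ (t ℕ.* s ℕ.* A ℕ.+ t ℕ.* C)
      ≡⟨ trans (ℕ→ℚ-+ (t ℕ.* s ℕ.* A) (t ℕ.* C))
           (cong₂ _+_ (trans (ℕ→ℚ-* (t ℕ.* s) A) (cong (_* ℕ→ℚ A) (ℕ→ℚ-* t s))) (ℕ→ℚ-* t C)) ⟩
    ℕ→ℚ t * ℕ→ℚ s * ℕ→ℚ A + ℕ→ℚ t * ℕ→ℚ C ∎
    where open ≡-Reasoning

  1/ℕ : ℕ → ℚ
  1/ℕ m = 1ℚ ÷ℕ m

  ÷ℕ≡*1/ℕ : ∀ q m → q ÷ℕ m ≡ q * 1/ℕ m
  ÷ℕ≡*1/ℕ q zero    = sym (*-zeroʳ q)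
  ÷ℕ≡*1/ℕ q (suc m) = cong (q *_) (sym (*-identityˡ _))

  ℕ→ℚ*1/ℕ : ∀ m .{{_ : NonZero m}} → ℕ→ℚ m * 1/ℕ m ≡ 1ℚ
  ℕ→ℚ*1/ℕ (suc m) = trans
    (cong₂ _*_ (normalize-coprime (coprime-sym (1-coprimeTo (suc m)))) (trans (*-identityˡ _) (normalize-coprime (1-coprimeTo (suc m)))))
    (*-inverseʳ (mkℚ (ℤ.+ suc m) 0 (coprime-sym (1-coprimeTo (suc m)))))

  -- D = Σ e(V'), A = e(V), B = e(∁ V), C crossing edges, p = n + t̄ - 1, t₁ = t - 1, ρ = 1/n, σ = 1/(t t̄), ν = 1/N.
  drift-algebra : ∀ {ρ σ ν A B C D M K K̄ t t̄ t₁ p : ℚ} →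
    t ≡ 1ℚ + t₁ → p ≡ t₁ + t̄ + t̄ → M ≡ A + B + C →
    D + (1ℚ + 1ℚ) * t̄ * A + C ≡ t * t̄ * A + t * C →
    (p * K + t₁ * K̄) * ν ≡ t₁ → t * t̄ * σ ≡ 1ℚ →
    (D - A * (t * t̄)) * ρ ≡ - ((p * ((A - K * M * ν) * ρ) + t₁ * ((B - K̄ * M * ν) * ρ)) * σ) * (t * t̄)
  drift-algebra {ρ} {σ} {ν} {A} {B} {C} {D} {M} {K} {K̄} {t} {t̄} {t₁} {p} refl refl refl hD hKν hσ = begin
    (D - A * (t * t̄)) * ρ
      ≡⟨ regroup ρ A B C D t̄ t₁ ⟩
    ((D + (1ℚ + 1ℚ) * t̄ * A + C) - (t * t̄ * A + t * C) - (p * A + t₁ * B - t₁ * M)) * ρ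
      ≡⟨ cong (λ X → (X - (t * t̄ * A + t * C) - (p * A + t₁ * B - t₁ * M)) * ρ) hD ⟩
    ((t * t̄ * A + t * C) - (t * t̄ * A + t * C) - (p * A + t₁ * B - t₁ * M)) * ρ
      ≡⟨ cancel ρ A B M (t * t̄ * A + t * C) t₁ p ⟩
    - ((p * A + t₁ * B - t₁ * M) * ρ) * 1ℚ
      ≡⟨ cong₂ (λ x y → - ((p * A + t₁ * B - x * M) * ρ) * y) (sym hKν) (sym hσ) ⟩
    - ((p * A + t₁ * B - (p * K + t₁ * K̄) * ν * M) * ρ) * (t * t̄ * σ)
      ≡⟨ distribute ρ σ ν A B M K K̄ t t̄ t₁ p ⟩
    - ((p * ((A - K * M * ν) * ρ) + t₁ * ((B - K̄ * M * ν) * ρ)) * σ) * (t * t̄) ∎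
    where
    open ≡-Reasoning
    regroup : ∀ ρ A B C D t̄ t₁ → (D - A * ((1ℚ + t₁) * t̄)) * ρ
      ≡ ((D + (1ℚ + 1ℚ) * t̄ * A + C) - ((1ℚ + t₁) * t̄ * A + (1ℚ + t₁) * C)
         - ((t₁ + t̄ + t̄) * A + t₁ * B - t₁ * (A + B + C))) * ρ
    regroup = solve-∀ ℚ-ring
    cancel : ∀ ρ A B M X t₁ p → (X - X - (p * A + t₁ * B - t₁ * M)) * ρ ≡ - ((p * A + t₁ * B - t₁ * M) * ρ) * 1ℚ
    cancel = solve-∀ ℚ-ring
    distribute : ∀ ρ σ ν A B M K K̄ t t̄ t₁ p → - ((p * A + t₁ * B - (p * K + t₁ * K̄) * ν * M) * ρ) * (t * t̄ * σ)
      ≡ - ((p * ((A - K * M * ν) * ρ) + t₁ * ((B - K̄ * M * ν) * ρ)) * σ) * (t * t̄)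
    distribute = solve-∀ ℚ-ring

  sumℚ-++ : ∀ (xs ys : List ℚ) → sumℚ (xs ++ ys) ≡ sumℚ xs + sumℚ ys
  sumℚ-++ []       ys = sym (+-identityˡ (sumℚ ys))
  sumℚ-++ (x ∷ xs) ys = trans (cong (x +_) (sumℚ-++ xs ys)) (sym (+-assoc x (sumℚ xs) (sumℚ ys)))

  module _ {A : Set} where

    sumℚ-concatMap : ∀ {B : Set} (h : B → ℚ) (f : A → List B) xs →
      sumℚ (map h (concatMap f xs)) ≡ sumℚ (map (λ x → sumℚ (map h (f x))) xs)
    sumℚ-concatMap h f []       = refl
    sumℚ-concatMap h f (x ∷ xs) = trans (cong sumℚ (map-++ h (f x) (concatMap f xs)))
      (trans (sumℚ-++ (map h (f x)) _) (cong (sumℚ (map h (f x)) +_) (sumℚ-concatMap h f xs)))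

    sumℚ-const : ∀ {h : A → ℚ} {c} xs → (∀ x → h x ≡ c) → sumℚ (map h xs) ≡ c * ℕ→ℚ (length xs)
    sumℚ-const {c = c} []       _   = sym (*-zeroʳ c)
    sumℚ-const {h} {c} (x ∷ xs) h≡c = begin
      h x + sumℚ (map h xs)                ≡⟨ cong₂ _+_ (h≡c x) (sumℚ-const xs h≡c) ⟩
      c + c * ℕ→ℚ (length xs)   ≡⟨ expand c (ℕ→ℚ (length xs)) ⟩
      c * (1ℚ + ℕ→ℚ (length xs)) ≡⟨ cong (c *_) (ℕ→ℚ-suc (length xs)) ⟨
      c * ℕ→ℚ (suc (length xs)) ∎
      where
      open ≡-Reasoning
      expand : ∀ c l → c + c * l ≡ c * (1ℚ + l)
      expand = solve-∀ ℚ-ring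

    sumℚ-affine : ∀ {h : A → ℚ} (f : A → ℕ) {α β} xs → (∀ x → h x ≡ α * ℕ→ℚ (f x) + β) →
      sumℚ (map h xs) ≡ α * ℕ→ℚ (sumₗ (map f xs)) + β * ℕ→ℚ (length xs)
    sumℚ-affine f {α} {β} []       _     = sym (collapse α β)
      where
      collapse : ∀ α β → α * 0ℚ + β * 0ℚ ≡ 0ℚ
      collapse = solve-∀ ℚ-ring
    sumℚ-affine {h} f {α} {β} (x ∷ xs) h≡αf+β = begin
      h x + sumℚ (map h xs)
        ≡⟨ cong₂ _+_ (h≡αf+β x) (sumℚ-affine f {α} {β} xs h≡αf+β) ⟩
      (α * ℕ→ℚ (f x) + β) + (α * ℕ→ℚ (sumₗ (map f xs)) + β * ℕ→ℚ (length xs))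
        ≡⟨ regroup α β (ℕ→ℚ (f x)) (ℕ→ℚ (sumₗ (map f xs))) (ℕ→ℚ (length xs)) ⟩
      α * (ℕ→ℚ (f x) + ℕ→ℚ (sumₗ (map f xs))) + β * (1ℚ + ℕ→ℚ (length xs))
        ≡⟨ cong₂ (λ u v → α * u + β * v) (ℕ→ℚ-+ (f x) _) (ℕ→ℚ-suc (length xs)) ⟨
      α * ℕ→ℚ (sumₗ (map f (x ∷ xs))) + β * ℕ→ℚ (length (x ∷ xs)) ∎
      where
      open ≡-Reasoning
      regroup : ∀ α β u s l → (α * u + β) + (α * s + β * l) ≡ α * (u + s) + β * (1ℚ + l)
      regroup = solve-∀ ℚ-ring

    sumℚ-filterᵇ-∝ : ∀ (p : A → Bool) {F H : A → ℚ} c xs → (∀ x → p x ≡ true → F x ≡ c * H x) →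
      sumℚ (map F (filterᵇ p xs)) ≡ c * sumℚ (map H (filterᵇ p xs))
    sumℚ-filterᵇ-∝ p c []       _   = sym (*-zeroʳ c)
    sumℚ-filterᵇ-∝ p {F} {H} c (x ∷ xs) F∝H with p x in px
    ... | true  = trans (cong₂ _+_ (F∝H x px) (sumℚ-filterᵇ-∝ p c xs F∝H)) (sym (*-distribˡ-+ c (H x) _))
    ... | false = sumℚ-filterᵇ-∝ p c xs F∝H

  cong₃ : ∀ {A B C D : Set} (f : A → B → C → D) {a a′ b b′ c c′} →
    a ≡ a′ → b ≡ b′ → c ≡ c′ → f a b c ≡ f a′ b′ c′
  cong₃ f refl refl refl = refl

  eqℚ²-true : ∀ p w → eqℚ² p w ≡ true → p ≡ w
  eqℚ²-true (a , b) (c , d) h with a ≟ c | b ≟ d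
  ... | yes refl | yes refl = refl
  ... | yes _    | no _     = contradiction h λ ()
  ... | no _     | _        = contradiction h λ ()

module Expectation where

  open Combinatorics
  open Rationals
  open import Data.Nat as ℕ using (ℕ; suc)
  import Data.Nat.Properties as ℕ
  open import Data.Nat.Combinatorics using (_C_)
  open import Data.Rational using (ℚ; 0ℚ; 1ℚ; _+_; _*_; -_; _-_)
  open import Data.Rational.Properties using (+-comm; *-comm; *-assoc; *-identityʳ; *-zeroʳ)
  open import Data.Bool using (true; false; not; T)
  open import Data.Bool.Properties using (not-involutive)
  open import Data.Fin using (Fin)
  open import Data.Fin.Subset using (Subset; ∁; ∣_∣)
  open import Data.Vec using (lookup)
  open import Data.Vec.Properties using (lookup-map)
  open import Data.List using (List; map; concatMap; filterᵇ; length; allFin)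
  open import Data.List.Properties using (map-cong; map-∘)
  open import Data.Nat.ListAction using () renaming (sum to sumₗ)
  open import Data.Product using (_×_; _,_; proj₁; proj₂)
  open import Function using (_∘_)
  open import Algebra.Properties.Semiring.Sum ℕ.+-*-semiring using (sum-cong-≗; sum-syntax)
  open import Tactic.RingSolver using (solve-∀)
  open import Relation.Binary.PropositionalEquality

  normalise≡ : ∀ {n} (G : Graph n) (k k̄ u KK : ℕ) → let open Setup G k k̄ in
    normalise u KK ≡ (ℕ→ℚ u - ℕ→ℚ KK * ℕ→ℚ M * 1/ℕ N) * 1/ℕ n
  normalise≡ {n} G k k̄ u KK = let open Setup G k k̄ in
    trans (÷ℕ≡*1/ℕ (ℕ→ℚ u - (ℕ→ℚ KK * ℕ→ℚ M) ÷ℕ N) n)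
      (cong (λ c → (ℕ→ℚ u - c) * 1/ℕ n) (÷ℕ≡*1/ℕ (ℕ→ℚ KK * ℕ→ℚ M) N))

  centring-identity : ∀ a b → let N = (suc a ℕ.+ suc b) C 2 in
    (ℕ→ℚ (a ℕ.+ suc b ℕ.+ suc b) * ℕ→ℚ (suc a C 2) + ℕ→ℚ a * ℕ→ℚ (suc b C 2)) * 1/ℕ N ≡ ℕ→ℚ a
  centring-identity a b = begin
    (ℕ→ℚ p * ℕ→ℚ K + ℕ→ℚ a * ℕ→ℚ K̄) * 1/ℕ N
      ≡⟨ cong (_* 1/ℕ N) (trans (ℕ→ℚ-+ (p ℕ.* K) (a ℕ.* K̄)) (cong₂ _+_ (ℕ→ℚ-* p K) (ℕ→ℚ-* a K̄))) ⟨
    ℕ→ℚ (p ℕ.* K ℕ.+ a ℕ.* K̄) * 1/ℕ N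
      ≡⟨ cong (λ x → ℕ→ℚ x * 1/ℕ N) (binomial-identity a b) ⟩
    ℕ→ℚ (a ℕ.* N) * 1/ℕ N
      ≡⟨ trans (cong (_* 1/ℕ N) (ℕ→ℚ-* a N)) (*-assoc (ℕ→ℚ a) (ℕ→ℚ N) (1/ℕ N)) ⟩
    ℕ→ℚ a * (ℕ→ℚ N * 1/ℕ N)
      ≡⟨ cong (ℕ→ℚ a *_) (ℕ→ℚ*1/ℕ N {{C2-nonZero a b}}) ⟩
    ℕ→ℚ a * 1ℚ
      ≡⟨ *-identityʳ (ℕ→ℚ a) ⟩
    ℕ→ℚ a ∎
    where
    open ≡-Reasoning
    p K K̄ N : ℕ
    p = a ℕ.+ suc b ℕ.+ suc b
    K = suc a C 2
    K̄ = suc b C 2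
    N = (suc a ℕ.+ suc b) C 2

  side-drift : ∀ {n t₁ t̄₁} (G : Graph n) (V : Subset n) → suc t₁ ℕ.+ suc t̄₁ ≡ n →
    count (lookup V) ≡ suc t₁ → count (not ∘ lookup V) ≡ suc t̄₁ →
    let open Setup G (suc t₁) (suc t̄₁) ; t = ℕ→ℚ (suc t₁) ; t̄ = ℕ→ℚ (suc t̄₁) in
    (ℕ→ℚ (SwapSum.swapSum G V) - ℕ→ℚ (e G V) * (t * t̄)) * 1/ℕ n
      ≡ - proj₁ (Λ (normalise (e G V) K , normalise (e G (∁ V)) K̄)) * (t * t̄)
  side-drift {n} {t₁} {t̄₁} G V refl |V| |∁V| = begin
    (ℕ→ℚ D - ℕ→ℚ A * (t * t̄)) * ρ
      ≡⟨ drift-algebra {ρ} {σ} {ν} {ℕ→ℚ A} {ℕ→ℚ B} {ℕ→ℚ Cut} {ℕ→ℚ D} {ℕ→ℚ M} {ℕ→ℚ K} {ℕ→ℚ K̄}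
           (ℕ→ℚ-suc t₁) p≡ M≡ hD hKν hσ ⟩
    - ((p * ((ℕ→ℚ A - ℕ→ℚ K * ℕ→ℚ M * ν) * ρ) + ℕ→ℚ t₁ * ((ℕ→ℚ B - ℕ→ℚ K̄ * ℕ→ℚ M * ν) * ρ)) * σ)
      * (t * t̄)
      ≡⟨ cong (λ x → - x * (t * t̄)) (sym Λ-unfold) ⟩
    - proj₁ (Λ (normalise A K , normalise B K̄)) * (t * t̄) ∎
    where
    open ≡-Reasoning
    open Setup G (suc t₁) (suc t̄₁)
    open EdgeCounts G
    open SwapSum G V using (swapSum; swapSum-count)
    t t̄ p ρ σ ν : ℚ
    t = ℕ→ℚ (suc t₁)
    t̄ = ℕ→ℚ (suc t̄₁)
    p = ℕ→ℚ (t₁ ℕ.+ suc t̄₁ ℕ.+ suc t̄₁)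
    ρ = 1/ℕ n
    σ = 1/ℕ (suc t₁ ℕ.* suc t̄₁)
    ν = 1/ℕ N
    A B Cut D : ℕ
    A = e G V
    B = e G (∁ V)
    Cut = crossing (lookup V)
    D = swapSum
    Λ-unfold : proj₁ (Λ (normalise A K , normalise B K̄))
      ≡ (p * ((ℕ→ℚ A - ℕ→ℚ K * ℕ→ℚ M * ν) * ρ) + ℕ→ℚ t₁ * ((ℕ→ℚ B - ℕ→ℚ K̄ * ℕ→ℚ M * ν) * ρ)) * σ
    Λ-unfold = trans (÷ℕ≡*1/ℕ (p * normalise A K + ℕ→ℚ t₁ * normalise B K̄) (suc t₁ ℕ.* suc t̄₁))
      (cong₂ (λ x y → (p * x + ℕ→ℚ t₁ * y) * σ)
        (normalise≡ G (suc t₁) (suc t̄₁) A K) (normalise≡ G (suc t₁) (suc t̄₁) B K̄))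
    p≡ : p ≡ ℕ→ℚ t₁ + t̄ + t̄
    p≡ = trans (ℕ→ℚ-+ (t₁ ℕ.+ suc t̄₁) (suc t̄₁)) (cong (_+ t̄) (ℕ→ℚ-+ t₁ (suc t̄₁)))
    M≡ : ℕ→ℚ M ≡ ℕ→ℚ A + ℕ→ℚ B + ℕ→ℚ Cut
    M≡ = trans (cong ℕ→ℚ (sym A+B+Cut≡M)) (trans (ℕ→ℚ-+ (A ℕ.+ B) Cut) (cong (_+ ℕ→ℚ Cut) (ℕ→ℚ-+ A B)))
      where
      A+B+Cut≡M : A ℕ.+ B ℕ.+ Cut ≡ M
      A+B+Cut≡M = trans (cong₂ (λ x y → x ℕ.+ y ℕ.+ Cut) (e≡inside V) (e-∁ V)) (inside+inside+crossing (lookup V))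
    hD : ℕ→ℚ D + (1ℚ + 1ℚ) * t̄ * ℕ→ℚ A + ℕ→ℚ Cut ≡ t * t̄ * ℕ→ℚ A + t * ℕ→ℚ Cut
    hD = ℕ→ℚ-identity D (suc t̄₁) A Cut (suc t₁)
      (subst (λ a → D ℕ.+ 2 ℕ.* suc t̄₁ ℕ.* a ℕ.+ Cut ≡ suc t₁ ℕ.* suc t̄₁ ℕ.* a ℕ.+ suc t₁ ℕ.* Cut)
        (sym (e≡inside V))
        (subst₂ (λ x y → D ℕ.+ 2 ℕ.* y ℕ.* inside (lookup V) ℕ.+ Cut ≡ x ℕ.* y ℕ.* inside (lookup V) ℕ.+ x ℕ.* Cut)
          |V| |∁V| swapSum-count))
    hKν : (p * ℕ→ℚ K + ℕ→ℚ t₁ * ℕ→ℚ K̄) * ν ≡ ℕ→ℚ t₁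
    hKν = centring-identity t₁ t̄₁
    hσ : t * t̄ * σ ≡ 1ℚ
    hσ = trans (cong (_* σ) (sym (ℕ→ℚ-* (suc t₁) (suc t̄₁)))) (ℕ→ℚ*1/ℕ (suc t₁ ℕ.* suc t̄₁))

  module Drift (a b : ℕ) (G : Graph (suc a ℕ.+ suc b)) where
    open Setup G (suc a) (suc b)

    n k k̄ : ℕ
    n = suc a ℕ.+ suc b
    k = suc a
    k̄ = suc b

    insiders outsiders : Subset n → List (Fin n)
    insiders  S = filterᵇ (lookup S) (allFin n)
    outsiders S = filterᵇ (not ∘ lookup S) (allFin n)

    block : Subset n → List (Outcome n)
    block S = concatMap (λ x → map (λ x̄ → (S , x , x̄)) (outsiders S)) (insiders S)

    P : ℚ
    P = prob n k k̄

    Δ : (ℚ × ℚ → ℚ) → Outcome n → ℚ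
    Δ π ω = π (𝐖' ω) - π (𝐖 ω)

    𝐖ˢ : Subset n → ℚ × ℚ
    𝐖ˢ S = normalise (e G S) K , normalise (e G (∁ S)) K̄

    Σblock : Subset n → (Fin n → Fin n → ℚ) → ℚ
    Σblock S h = sumℚ (map (λ x → sumℚ (map (h x) (outsiders S))) (insiders S))

    sum-block : ∀ S (h : Outcome n → ℚ) → sumℚ (map h (block S)) ≡ Σblock S (λ x x̄ → h (S , x , x̄))
    sum-block S h = trans (sumℚ-concatMap h _ (insiders S))
      (cong sumℚ (map-cong (λ x → cong sumℚ (sym (map-∘ (outsiders S)))) (insiders S)))

    Σblock-cong : ∀ S {h h′ : Fin n → Fin n → ℚ} → (∀ x x̄ → h x x̄ ≡ h′ x x̄) → Σblock S h ≡ Σblock S h′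
    Σblock-cong S h≡h′ = cong sumℚ (map-cong (λ x → cong sumℚ (map-cong (h≡h′ x) (outsiders S))) (insiders S))

    module _ {S : Subset n} (|S| : ∣ S ∣ ≡ k) where

      count-S : count (lookup S) ≡ k
      count-S = trans (sym (∣∣≡count S)) |S|

      count-∁S : count (not ∘ lookup S) ≡ k̄
      count-∁S = ℕ.+-cancelˡ-≡ k (count (not ∘ lookup S)) k̄
        (trans (cong (ℕ._+ count (not ∘ lookup S)) (sym count-S)) (count-∁ (lookup S)))

      Σblock-const : ∀ {h c} → (∀ x x̄ → h x x̄ ≡ c) → Σblock S h ≡ c * ℕ→ℚ k̄ * ℕ→ℚ k
      Σblock-const {h} {c} h≡c = begin
        Σblock S h
          ≡⟨ sumℚ-const (insiders S) (λ x → sumℚ-const (outsiders S) (h≡c x)) ⟩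
        c * ℕ→ℚ (length (outsiders S)) * ℕ→ℚ (length (insiders S))
          ≡⟨ cong₂ (λ l l̄ → c * ℕ→ℚ l̄ * ℕ→ℚ l) (trans (length-filterᵇ-allFin (lookup S)) count-S)
               (trans (length-filterᵇ-allFin (not ∘ lookup S)) count-∁S) ⟩
        c * ℕ→ℚ k̄ * ℕ→ℚ k ∎
        where open ≡-Reasoning

      swapTotal : (Fin n → Fin n → ℕ) → ℕ
      swapTotal E = ∑[ x < n ] (⟦ lookup S x ⟧ ℕ.* ∑[ x̄ < n ] (⟦ not (lookup S x̄) ⟧ ℕ.* E x x̄))

      Σblock-affine : ∀ {h α β} (E : Fin n → Fin n → ℕ) → (∀ x x̄ → h x x̄ ≡ α * ℕ→ℚ (E x x̄) + β) →
        Σblock S h ≡ α * ℕ→ℚ (swapTotal E) + β * ℕ→ℚ k̄ * ℕ→ℚ k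
      Σblock-affine {h} {α} {β} E h≡αE+β = begin
        Σblock S h
          ≡⟨ sumℚ-affine (λ x → sumₗ (map (E x) (outsiders S))) {α} {β * ℕ→ℚ (length (outsiders S))} (insiders S)
               (λ x → sumℚ-affine (E x) {α} {β} (outsiders S) (h≡αE+β x)) ⟩
        α * ℕ→ℚ (sumₗ (map (λ x → sumₗ (map (E x) (outsiders S))) (insiders S)))
          + β * ℕ→ℚ (length (outsiders S)) * ℕ→ℚ (length (insiders S))
          ≡⟨ cong₃ (λ D l̄ l → α * ℕ→ℚ D + β * ℕ→ℚ l̄ * ℕ→ℚ l) total
               (trans (length-filterᵇ-allFin (not ∘ lookup S)) count-∁S)
               (trans (length-filterᵇ-allFin (lookup S)) count-S) ⟩
        α * ℕ→ℚ (swapTotal E) + β * ℕ→ℚ k̄ * ℕ→ℚ k ∎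
        where
        open ≡-Reasoning
        total : sumₗ (map (λ x → sumₗ (map (E x) (outsiders S))) (insiders S)) ≡ swapTotal E
        total = trans (sumₗ-filterᵇ-allFin (lookup S) _)
          (sum-cong-≗ λ x → cong (⟦ lookup S x ⟧ ℕ.*_) (sumₗ-filterᵇ-allFin (not ∘ lookup S) (E x)))

      block-drift : ∀ (E : Fin n → Fin n → ℕ) (A KK : ℕ) →
        Σblock S (λ x x̄ → P * (normalise (E x x̄) KK - normalise A KK))
          ≡ P * ((ℕ→ℚ (swapTotal E) - ℕ→ℚ A * (ℕ→ℚ k̄ * ℕ→ℚ k)) * 1/ℕ n)
      block-drift E A KK = trans (Σblock-affine {α = P * 1/ℕ n} {β = - (P * 1/ℕ n * ℕ→ℚ A)} E λ x x̄ → pointwise (E x x̄))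
        (collect P (1/ℕ n) (ℕ→ℚ (swapTotal E)) (ℕ→ℚ A) (ℕ→ℚ k̄) (ℕ→ℚ k))
        where
        pointwise : ∀ u → P * (normalise u KK - normalise A KK) ≡ P * 1/ℕ n * ℕ→ℚ u + - (P * 1/ℕ n * ℕ→ℚ A)
        pointwise u = trans (cong₂ (λ x y → P * (x - y)) (normalise≡ G k k̄ u KK) (normalise≡ G k k̄ A KK))
          (difference P (1/ℕ n) (ℕ→ℚ KK * ℕ→ℚ M * 1/ℕ N) (ℕ→ℚ u) (ℕ→ℚ A))
          where
          difference : ∀ P ρ c u A → P * ((u - c) * ρ - (A - c) * ρ) ≡ P * ρ * u + - (P * ρ * A)
          difference = solve-∀ ℚ-ring
        collect : ∀ P ρ D A x y → P * ρ * D + - (P * ρ * A) * x * y ≡ P * ((D - A * (x * y)) * ρ)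
        collect = solve-∀ ℚ-ring

      drift₁ : Σblock S (λ x x̄ → P * Δ proj₁ (S , x , x̄))
                 ≡ - proj₁ (Λ (𝐖ˢ S)) * (P * ℕ→ℚ k̄ * ℕ→ℚ k)
      drift₁ = begin
        Σblock S (λ x x̄ → P * Δ proj₁ (S , x , x̄))
          ≡⟨ block-drift (λ x x̄ → e G (swapped S x x̄)) (e G S) K ⟩
        P * ((ℕ→ℚ (SwapSum.swapSum G S) - ℕ→ℚ (e G S) * (ℕ→ℚ k̄ * ℕ→ℚ k)) * 1/ℕ n)
          ≡⟨ cong (λ x → P * ((ℕ→ℚ (SwapSum.swapSum G S) - ℕ→ℚ (e G S) * x) * 1/ℕ n)) (*-comm (ℕ→ℚ k̄) (ℕ→ℚ k)) ⟩
        P * ((ℕ→ℚ (SwapSum.swapSum G S) - ℕ→ℚ (e G S) * (ℕ→ℚ k * ℕ→ℚ k̄)) * 1/ℕ n)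
          ≡⟨ cong (P *_) (side-drift G S refl count-S count-∁S) ⟩
        P * (- proj₁ (Λ (𝐖ˢ S)) * (ℕ→ℚ k * ℕ→ℚ k̄))
          ≡⟨ rearrange P (proj₁ (Λ (𝐖ˢ S))) (ℕ→ℚ k) (ℕ→ℚ k̄) ⟩
        - proj₁ (Λ (𝐖ˢ S)) * (P * ℕ→ℚ k̄ * ℕ→ℚ k) ∎
        where
        open ≡-Reasoning
        rearrange : ∀ P L x y → P * (- L * (x * y)) ≡ - L * (P * y * x)
        rearrange = solve-∀ ℚ-ring

      -- S̄' swaps x̄ out of ∁ S and x in, so this is the first coordinate for ∁ S.
      drift₂ : Σblock S (λ x x̄ → P * Δ proj₂ (S , x , x̄))
                 ≡ - proj₂ (Λ (𝐖ˢ S)) * (P * ℕ→ℚ k̄ * ℕ→ℚ k)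
      drift₂ = begin
        Σblock S (λ x x̄ → P * Δ proj₂ (S , x , x̄))
          ≡⟨ block-drift (λ x x̄ → e G (swapped (∁ S) x̄ x)) (e G (∁ S)) K̄ ⟩
        P * ((ℕ→ℚ (swapTotal (λ x x̄ → e G (swapped (∁ S) x̄ x))) - ℕ→ℚ (e G (∁ S)) * (ℕ→ℚ k̄ * ℕ→ℚ k)) * 1/ℕ n)
          ≡⟨ cong (λ D → P * ((ℕ→ℚ D - ℕ→ℚ (e G (∁ S)) * (ℕ→ℚ k̄ * ℕ→ℚ k)) * 1/ℕ n))
               (∑∁-reindex S λ y z → e G (swapped (∁ S) y z)) ⟩
        P * ((ℕ→ℚ (SwapSum.swapSum G (∁ S)) - ℕ→ℚ (e G (∁ S)) * (ℕ→ℚ k̄ * ℕ→ℚ k)) * 1/ℕ n)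
          ≡⟨ cong (P *_) (side-drift G (∁ S) (ℕ.+-comm k̄ k) count-∁ᵛ count-∁∁ᵛ) ⟩
        P * (- proj₁ (Setup.Λ G k̄ k (normalise (e G (∁ S)) K̄ , normalise (e G (∁ (∁ S))) K)) * (ℕ→ℚ k̄ * ℕ→ℚ k))
          ≡⟨ cong (λ L → P * (- L * (ℕ→ℚ k̄ * ℕ→ℚ k))) Λ-swap ⟩
        P * (- proj₂ (Λ (𝐖ˢ S)) * (ℕ→ℚ k̄ * ℕ→ℚ k))
          ≡⟨ rearrange P (proj₂ (Λ (𝐖ˢ S))) (ℕ→ℚ k̄) (ℕ→ℚ k) ⟩
        - proj₂ (Λ (𝐖ˢ S)) * (P * ℕ→ℚ k̄ * ℕ→ℚ k) ∎
        where
        open ≡-Reasoning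
        count-∁ᵛ : count (lookup (∁ S)) ≡ k̄
        count-∁ᵛ = trans (sum-cong-≗ λ i → cong ⟦_⟧ (lookup-map i not S)) count-∁S
        count-∁∁ᵛ : count (not ∘ lookup (∁ S)) ≡ k
        count-∁∁ᵛ = trans (sum-cong-≗ λ i → cong (⟦_⟧ ∘ not) (lookup-map i not S))
          (trans (sum-cong-≗ λ i → cong ⟦_⟧ (not-involutive (lookup S i))) count-S)
        Λ-swap : proj₁ (Setup.Λ G k̄ k (normalise (e G (∁ S)) K̄ , normalise (e G (∁ (∁ S))) K)) ≡ proj₂ (Λ (𝐖ˢ S))
        Λ-swap = cong₂ _÷ℕ_
          (trans (cong (λ V → ℕ→ℚ (n ℕ.+ k ℕ.∸ 1) * normalise (e G (∁ S)) K̄ + ℕ→ℚ (k̄ ℕ.∸ 1) * normalise (e G V) K) (∁-involutive S))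
                 (+-comm (ℕ→ℚ (n ℕ.+ k ℕ.∸ 1) * normalise (e G (∁ S)) K̄) (ℕ→ℚ (k̄ ℕ.∸ 1) * normalise (e G S) K)))
          (ℕ.*-comm k̄ k)
        rearrange : ∀ P L x y → P * (- L * (x * y)) ≡ - L * (P * x * y)
        rearrange = solve-∀ ℚ-ring

      -- 𝐖 is constant on the block of S, so the indicator is 1 on all of it or on none of it.
      block-∝ : ∀ (d : Outcome n → ℚ) (ℓ : ℚ × ℚ → ℚ) w →
        Σblock S (λ x x̄ → P * d (S , x , x̄)) ≡ - ℓ (𝐖ˢ S) * (P * ℕ→ℚ k̄ * ℕ→ℚ k) →
        sumℚ (map (λ ω → P * (d ω * 𝟙 (eqℚ² (𝐖 ω) w))) (block S))
          ≡ (- ℓ w) * sumℚ (map (λ ω → P * 𝟙 (eqℚ² (𝐖 ω) w)) (block S))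
      block-∝ d ℓ w drift = begin
        sumℚ (map (λ ω → P * (d ω * 𝟙 (eqℚ² (𝐖 ω) w))) (block S))
          ≡⟨ sum-block S _ ⟩
        Σblock S (λ x x̄ → P * (d (S , x , x̄) * 𝟙 (eqℚ² (𝐖ˢ S) w)))
          ≡⟨ by-cases (eqℚ² (𝐖ˢ S) w) refl ⟩
        (- ℓ w) * Σblock S (λ _ _ → P * 𝟙 (eqℚ² (𝐖ˢ S) w))
          ≡⟨ cong ((- ℓ w) *_) (sum-block S _) ⟨
        (- ℓ w) * sumℚ (map (λ ω → P * 𝟙 (eqℚ² (𝐖 ω) w)) (block S)) ∎
        where
        open ≡-Reasoning
        by-cases : ∀ β → eqℚ² (𝐖ˢ S) w ≡ β →
          Σblock S (λ x x̄ → P * (d (S , x , x̄) * 𝟙 (eqℚ² (𝐖ˢ S) w)))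
            ≡ (- ℓ w) * Σblock S (λ _ _ → P * 𝟙 (eqℚ² (𝐖ˢ S) w))
        by-cases true  eq = begin
          Σblock S (λ x x̄ → P * (d (S , x , x̄) * 𝟙 (eqℚ² (𝐖ˢ S) w)))
            ≡⟨ Σblock-cong S (λ x x̄ → trans (cong (λ β → P * (d (S , x , x̄) * 𝟙 β)) eq)
                 (cong (P *_) (*-identityʳ (d (S , x , x̄))))) ⟩
          Σblock S (λ x x̄ → P * d (S , x , x̄))
            ≡⟨ drift ⟩
          - ℓ (𝐖ˢ S) * (P * ℕ→ℚ k̄ * ℕ→ℚ k)
            ≡⟨ cong₂ (λ v m → - ℓ v * m) (sym (eqℚ²-true (𝐖ˢ S) w eq))
                 (Σblock-const λ _ _ → trans (cong (λ β → P * 𝟙 β) eq) (*-identityʳ P)) ⟨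
          (- ℓ w) * Σblock S (λ _ _ → P * 𝟙 (eqℚ² (𝐖ˢ S) w)) ∎
        by-cases false eq = begin
          Σblock S (λ x x̄ → P * (d (S , x , x̄) * 𝟙 (eqℚ² (𝐖ˢ S) w)))
            ≡⟨ Σblock-const (λ x x̄ → trans (cong (λ β → P * (d (S , x , x̄) * 𝟙 β)) eq)
                 (trans (cong (P *_) (*-zeroʳ (d (S , x , x̄)))) (*-zeroʳ P))) ⟩
          0ℚ * ℕ→ℚ k̄ * ℕ→ℚ k
            ≡⟨ absorb (- ℓ w) (ℕ→ℚ k̄) (ℕ→ℚ k) ⟩
          (- ℓ w) * (0ℚ * ℕ→ℚ k̄ * ℕ→ℚ k)
            ≡⟨ cong ((- ℓ w) *_) (Σblock-const λ _ _ → trans (cong (λ β → P * 𝟙 β) eq) (*-zeroʳ P)) ⟨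
          (- ℓ w) * Σblock S (λ _ _ → P * 𝟙 (eqℚ² (𝐖ˢ S) w)) ∎
          where
          absorb : ∀ c x y → 0ℚ * x * y ≡ c * (0ℚ * x * y)
          absorb = solve-∀ ℚ-ring

    expectation-∝ : ∀ (X Y : Outcome n → ℚ) c →
      (∀ S → ∣ S ∣ ≡ k → sumℚ (map (λ ω → P * X ω) (block S)) ≡ c * sumℚ (map (λ ω → P * Y ω) (block S))) →
      𝔼 n k k̄ X ≡ c * 𝔼 n k k̄ Y
    expectation-∝ X Y c blocks∝ = trans (sumℚ-concatMap (λ ω → P * X ω) block kSubsets)
      (trans (sumℚ-filterᵇ-∝ (λ S → ∣ S ∣ ℕ.≡ᵇ k) c (allSubsets n)
               λ S |S|≡ᵇk → blocks∝ S (ℕ.≡ᵇ⇒≡ ∣ S ∣ k (subst T (sym |S|≡ᵇk) _)))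
        (cong (c *_) (sym (sumℚ-concatMap (λ ω → P * Y ω) block kSubsets))))
      where
      kSubsets : List (Subset n)
      kSubsets = filterᵇ (λ S → ∣ S ∣ ℕ.≡ᵇ k) (allSubsets n)

    claim : CondExpClaim
    claim w = conditional proj₁ (λ {S} → drift₁ {S}) , conditional proj₂ (λ {S} → drift₂ {S})
      where
      conditional : ∀ π →
        (∀ {S} (|S| : ∣ S ∣ ≡ k) → Σblock S (λ x x̄ → P * Δ π (S , x , x̄)) ≡ - π (Λ (𝐖ˢ S)) * (P * ℕ→ℚ k̄ * ℕ→ℚ k)) →
        𝔼 n k k̄ (λ ω → Δ π ω * 𝟙 (eqℚ² (𝐖 ω) w)) ≡ (- π (Λ w)) * 𝔼 n k k̄ (λ ω → 𝟙 (eqℚ² (𝐖 ω) w))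
      conditional π drift = expectation-∝ _ _ (- π (Λ w))
        λ S |S| → block-∝ {S} |S| (Δ π) (π ∘ Λ) w (drift {S} |S|)

open import Data.Nat using (ℕ; _+_; _<_; suc)
open import Relation.Binary.PropositionalEquality using (_≡_; refl)

lemma2p2 : ∀ {n : ℕ} (G : Graph n) (k k̄ : ℕ) → 0 < k → 0 < k̄ → k + k̄ ≡ n →
    Setup.CondExpClaim G k k̄
lemma2p2 G (suc a) (suc b) _ _ refl = Expectation.Drift.claim a b G
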